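{- Let $G$ be a finite, undirected, simple, connected graph. If $G$ is $\{\text{hole}, D, X_5, F\}$-free, then $G\in\mathbf{m_3}/\mathbf{SP}$.
   Context: All graphs are finite, undirected, simple and connected. A $uv$-walk is a sequence of (not necessarily distinct) vertices $W: u=v_0,v_1,\ldots,v_n=v$ with $v_{i-1}$ adjacent to $v_i$ for all $i\in\{1,\ldots,n\}$; $v_1,\ldots,v_{n-1}$ are its internal vertices and $n$ is its length. A $uv$-path is a $uv$-walk with distinct vertices. A $uv$-induced path is a $uv$-path in which two vertices are adjacent in $G$ if and only if they are consecutive on the path. For non-adjacent vertices $u,v$: - $\mathbf{m_3}(u,v)$ is the set of $uv$-$m_3$ paths, i.e. $uv$-induced paths of length at least three. - $\mathbf{SP}(u,v)$ is the set of $uv$-shortest paths, i.e. $uv$-paths of length equal to the distance $d(u,v)$ in $G$. Domination: for non-adjacent $u,v$, a $uv$-walk $W$ dominates a $uv$-walk $W'$ if every internal vertex of $W'$ is adjacent to some internal vertex of $W$ or belongs to $W$. The class $\mathbf{A}/\mathbf{B}$ consists of all graphs $G$ such that for every pair of non-adjacent vertices $u,v$ of $G$, every walk $W\in\mathbf{A}(u,v)$ dominates every walk $W'\in\mathbf{B}(u,v)$ (vacuously true if one of the sets is empty). A graph is $\mathcal{F}$-free if it contains no induced subgraph isomorphic to a member of $\mathcal{F}$. The graphs involved are: - a hole: a chordless cycle with at least five vertices (every such cycle is forbidden); - $D$ (domino): vertices $x_0,\ldots,x_5$, edges $x_0x_1,x_1x_2,x_2x_3,x_3x_4,x_4x_5,x_0x_5,x_1x_4$;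 - $X_5$: vertices $x_0,\ldots,x_5$, edges $x_0x_1,x_0x_5,x_1x_2,x_1x_5,x_2x_3,x_2x_5,x_3x_4,x_4x_5$; - $F$: vertices $x_0,\ldots,x_6$, edges $x_0x_1,x_0x_6,x_1x_2,x_2x_6,x_5x_6,x_2x_3,x_2x_5,x_3x_4,x_4x_5$. -}

module Defs where

open import Data.Bool.Base using (Bool; T)
open import Data.Fin.Base using (Fin; zero; suc; toℕ; fromℕ; inject₁)
open import Data.Fin.Patterns using (0F; 1F; 2F; 3F; 4F; 5F; 6F)
import Data.Fin.Properties as Fin
open import Data.List.Base using (List; []; _∷_)
import Data.List.Membership.DecPropositional as DecMembership
open import Data.Nat.Base as ℕ using (ℕ; _≤_; _<_)
import Data.Nat.Properties as ℕ
open import Data.Product.Base using (∃; ∃-syntax; _×_; _,_; proj₁; map)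
import Data.Product.Properties as Product
open import Data.Sum.Base using (_⊎_; swap)
open import Function.Base using (_∘_)
open import Function.Bundles using (_↔_; _⇔_; module Inverse)
open import Function.Definitions using (Injective)
open import Level using (0ℓ) renaming (suc to lsuc)
open import Relation.Binary.Core using (Rel)
open import Relation.Binary.Definitions using (Decidable; Symmetric)
open import Relation.Binary.PropositionalEquality.Core using (_≡_; _≢_; refl; ≢-sym)
open import Relation.Nullary.Decidable using (_×-dec_; _⊎-dec_; ¬?)
open import Relation.Nullary.Negation.Core using (¬_)
open import Relation.Unary using (Pred; _∈_)

-- Classically `adj?` holds for every graph; constructively it is part of
-- what it means to be given a finite graph.

record Graph : Set₁ where
  field
    Vertex : Set
    Adj    : Rel Vertex 0ℓ
    adj?   : Decidable Adj
    sym    : Symmetric Adj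
    irrefl : ∀ {v} → ¬ Adj v v

open Graph public using (Vertex)

Finite : Pred Graph 0ℓ
Finite G = ∃[ n ] (Vertex G ↔ Fin n)

infix 4 _≅_

record _≅_ (G H : Graph) : Set where
  field
    vertices : Vertex G ↔ Vertex H
  open Inverse vertices public using (to; from)
  field
    adjacent : ∀ x y → Graph.Adj G x y ⇔ Graph.Adj H (to x) (to y)

-- The vertex set is Boolean-valued so that equality of vertices of the
-- subgraph is equality of the underlying vertices.

induced : (G : Graph) → (Vertex G → Bool) → Graph
induced G S = record
  { Vertex = ∃[ v ] T (S v)
  ; Adj    = λ x y → Adj (proj₁ x) (proj₁ y)
  ; adj?   = λ x y → adj? (proj₁ x) (proj₁ y)
  ; sym    = sym
  ; irrefl = irrefl
  }
  where open Graph G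

Free : Pred Graph 0ℓ → Pred Graph (lsuc 0ℓ)
Free 𝓕 G = ∀ {H} → H ∈ 𝓕 → (S : Vertex G → Bool) → ¬ (induced G S ≅ H)

record Walk (G : Graph) (u v : Vertex G) : Set where
  field
    length : ℕ
    vertex : Fin (ℕ.suc length) → Vertex G
    start  : vertex zero ≡ u
    end    : vertex (fromℕ length) ≡ v
    step   : ∀ i → Graph.Adj G (vertex (inject₁ i)) (vertex (suc i))

open Walk public using (length; vertex)

Connected : Pred Graph 0ℓ
Connected G = (u v : Vertex G) → Walk G u v

module _ {G : Graph} {u v : Vertex G} where

  open Graph G using (Adj)

  infix 4 _∈ᵂ_

  _∈ᵂ_ : Vertex G → Walk G u v → Set
  x ∈ᵂ W = ∃[ i ] (vertex W i ≡ x)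

  -- Internality is a matter of position: an endpoint revisited at an
  -- intermediate position of a walk is also an internal vertex.

  Internal : Walk G u v → Pred (Vertex G) 0ℓ
  Internal W x = ∃[ i ] (0 < toℕ i × toℕ i < length W × vertex W i ≡ x)

  IsPath : Pred (Walk G u v) 0ℓ
  IsPath W = Injective _≡_ _≡_ (vertex W)

  IsInducedPath : Pred (Walk G u v) 0ℓ
  IsInducedPath W = IsPath W ×
    (∀ i j → Adj (vertex W i) (vertex W j) ⇔
             (toℕ j ≡ ℕ.suc (toℕ i) ⊎ toℕ i ≡ ℕ.suc (toℕ j)))

  Dominates : (W W′ : Walk G u v) → Set
  Dominates W W′ = ∀ x → Internal W′ x → (∃[ y ] (Internal W y × Adj x y)) ⊎ x ∈ᵂ W

IsDistance : (G : Graph) (u v : Vertex G) → Pred ℕ 0ℓ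
IsDistance G u v d =
  (∃[ P ] (IsPath {G} {u} {v} P × length P ≡ d)) ×
  (∀ (P : Walk G u v) → IsPath P → d ≤ length P)

WalkClass : Set₁
WalkClass = (G : Graph) (u v : Vertex G) → Pred (Walk G u v) 0ℓ

m₃ : WalkClass
m₃ G u v W = IsInducedPath W × 3 ≤ length W

SP : WalkClass
SP G u v W = IsPath W × IsDistance G u v (length W)

infix 7 _/_

_/_ : WalkClass → WalkClass → Pred Graph 0ℓ
(A / B) G = ∀ (u v : Vertex G) → ¬ Graph.Adj G u v →
            ∀ W W′ → W ∈ A G u v → W′ ∈ B G u v → Dominates W W′

-- Two distinct vertices are adjacent when R relates them in either order.

fromRel : {V : Set} {R : Rel V 0ℓ} → Decidable {A = V} _≡_ → Decidable R → Graph
fromRel {V} {R} _≟_ R? = record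
  { Vertex = V
  ; Adj    = λ x y → x ≢ y × (R x y ⊎ R y x)
  ; adj?   = λ x y → ¬? (x ≟ y) ×-dec (R? x y ⊎-dec R? y x)
  ; sym    = map ≢-sym swap
  ; irrefl = λ p → proj₁ p refl
  }

fromEdges : (n : ℕ) → List (Fin n × Fin n) → Graph
fromEdges n es = fromRel Fin._≟_ (λ x y → (x , y) ∈? es)
  where open DecMembership (Product.≡-dec (Fin._≟_ {n}) (Fin._≟_ {n})) using (_∈?_)

cycle : ℕ → Graph
cycle n = fromRel {Fin n} Fin._≟_ λ i j →
  (toℕ j ℕ.≟ ℕ.suc (toℕ i)) ⊎-dec ((ℕ.suc (toℕ i) ℕ.≟ n) ×-dec (toℕ j ℕ.≟ 0))

domino : Graph
domino = fromEdges 6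
  ((0F , 1F) ∷ (1F , 2F) ∷ (2F , 3F) ∷ (3F , 4F) ∷ (4F , 5F) ∷ (0F , 5F) ∷ (1F , 4F) ∷ [])

X₅ : Graph
X₅ = fromEdges 6
  ((0F , 1F) ∷ (0F , 5F) ∷ (1F , 2F) ∷ (1F , 5F) ∷ (2F , 3F) ∷ (2F , 5F) ∷ (3F , 4F) ∷
   (4F , 5F) ∷ [])

F : Graph
F = fromEdges 7
  ((0F , 1F) ∷ (0F , 6F) ∷ (1F , 2F) ∷ (2F , 6F) ∷ (5F , 6F) ∷ (2F , 3F) ∷ (2F , 5F) ∷
   (3F , 4F) ∷ (4F , 5F) ∷ [])

data Hole-D-X₅-F : Pred Graph 0ℓ where
  is-hole   : ∀ n → 5 ≤ n → Hole-D-X₅-F (cycle n)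
  is-domino : Hole-D-X₅-F domino
  is-X₅     : Hole-D-X₅-F X₅
  is-F      : Hole-D-X₅-F F

{-# OPTIONS --safe #-}
module Submission where

-- Suppose x = p(k+1) is an internal vertex of the shortest path p which the induced
-- path w does not dominate, with neighbours a = p(k) and b = p(k+2) on p.  Reversing
-- both paths if necessary, p continues with c = p(k+3), unless p has length two, in
-- which case w and x form a hole.  The vertices of w and p other than a, x and b
-- are not adjacent to x and connect a to b, so an induced path from a to b through
-- them closes up with x to a hole unless it has a single internal vertex, which must
-- be an internal vertex y = w(i) of w.  For the last such i, a has no neighbour on w beyond
-- y: otherwise the same argument beyond y gives a hole.  Let s = w(i+1), the only
-- neighbour of y on the stretch R leading along w from s to the end and back along p
-- to c.  If s and b are not adjacent, an induced path from s to b in R closes up with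
-- y to a hole, or together with a and x forms a domino.  If s and b are adjacent,
-- follow an induced path in R from s to the next neighbour of b: according to its
-- length, 1, 2 or more, it yields X₅, F or a hole.

open import Data.Bool.Base using (Bool; if_then_else_)
open import Data.Bool.Properties using (T-irrelevant)
open import Data.Empty using (⊥; ⊥-elim)
open import Data.Fin.Base as Fin using (Fin; zero; suc; toℕ; fromℕ; inject₁)
import Data.Fin.Properties as Fin
open import Data.List.Base as List using (List; []; _∷_; lookup; filter; cartesianProduct; allFin)
open import Data.List.Membership.Propositional.Properties
  using (∈-filter⁺; ∈-cartesianProduct⁺; ∈-allFin; ∈-lookup)
open import Data.List.Relation.Unary.All as All using (All; []; _∷_)
open import Data.List.Relation.Unary.All.Properties.Core using (¬Any⇒All¬)
open import Data.List.Relation.Unary.Any using (Any; any?; here; there)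
open import Data.Nat.Base using (ℕ; zero; suc; _+_; _∸_; _≤_; _<_; z≤n; s≤s; s≤s⁻¹)
import Data.Nat.Properties as ℕ
open import Data.Product.Base using (∃; ∃-syntax; _×_; _,_; proj₁; proj₂)
open import Data.Product.Properties using (Σ-≡,≡→≡; ×-≡,≡→≡)
open import Data.Sum.Base as Sum using (_⊎_; inj₁; inj₂; swap)
open import Data.Unit.Base using (tt)
open import Data.Vec.Base as Vec using (Vec; []; _∷_)
open import Defs
open import Function.Base using (_∘_)
open import Function.Bundles using (_⇔_; mk⇔; mk↔ₛ′; module Equivalence)
open import Function.Definitions using (Injective)
open import Function.Properties.Inverse using (↔⇒↣)
open import Level using (0ℓ)
open import Relation.Binary.Core using (Rel)
open import Relation.Binary.Definitions using (DecidableEquality; Trichotomous; tri<; tri≈; tri>)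
open import Relation.Binary.PropositionalEquality
  using (_≡_; _≢_; refl; sym; trans; cong; subst; ≢-sym)
open import Relation.Nullary.Decidable
  using (Dec; yes; no; does; ⌊_⌋; True; toWitness; fromWitness;
    _×-dec_; _→-dec_; _⊎-dec_; ¬?; via-injection)
open import Relation.Nullary.Negation.Core using (¬_; contradiction)
open import Relation.Unary as Unary using (Pred; _∈_; _∩_; ∁; U)

-- Recognising a pattern as an induced subgraph.

-- Twins here share an open neighbourhood. The domino, `X₅` and `F` have none, so an adjacency table
-- alone certifies an embedding, without a list of inequalities.
Twinless : Graph → Set
Twinless H = ∀ i j → (∀ k → Adj i k → Adj j k) → (∀ k → Adj j k → Adj i k) → i ≡ j
  where open Graph H using (Adj)

twinless? : ∀ n es → Dec (Twinless (fromEdges n es))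
twinless? n es = Fin.all? λ i → Fin.all? λ j →
  Fin.all? (λ k → adj? i k →-dec adj? j k) →-dec
  Fin.all? (λ k → adj? j k →-dec adj? i k) →-dec
  (i Fin.≟ j)
  where open Graph (fromEdges n es) using (adj?)

Decides : {A : Set} → Dec A → Set → Set
Decides a? B = if does a? then B else ¬ B

Decides⇒⇔ : {A B : Set} (a? : Dec A) → Decides a? B → B ⇔ A
Decides⇒⇔ (yes a) b  = mk⇔ (λ _ → a) (λ _ → b)
Decides⇒⇔ (no ¬a) ¬b = mk⇔ (⊥-elim ∘ ¬b) (⊥-elim ∘ ¬a)

ascendingPairs : (n : ℕ) → List (Fin n × Fin n)
ascendingPairs n = filter (λ (i , j) → i Fin.<? j) (cartesianProduct (allFin n) (allFin n))

module _ (G : Graph) (_≟_ : DecidableEquality (Vertex G)) where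

  open Graph G using (Adj; adj?; irrefl) renaming (sym to Adj-sym)

  Adj⇒≢ : ∀ {x y} → Adj x y → x ≢ y
  Adj⇒≢ e refl = irrefl e

  Embeds : Graph → Set
  Embeds H = ∃[ f ] (Injective _≡_ _≡_ f × (∀ i j → Adj (f i) (f j) ⇔ Graph.Adj H i j))

  module _ {H : Graph} where

    -- Searching the vertices of `H` decides the image of `f`, which can therefore serve as the
    -- Boolean vertex set `S`.
    Embeds⇒induced : (∀ {P : Pred (Vertex H) 0ℓ} → Unary.Decidable P → Dec (∃ P)) →
      Embeds H → ∃[ S ] (induced G S ≅ H)
    Embeds⇒induced search (f , f-injective , f-adj) = S , record
      { vertices = mk↔ₛ′ index vertexAt
          (λ i → f-injective (index-correct (vertexAt i)))
          (λ x → Σ-≡,≡→≡ (index-correct x , T-irrelevant _ _))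
      ; adjacent = λ x y → subst (λ (a , b) → Adj a b ⇔ Graph.Adj H (index x) (index y))
          (×-≡,≡→≡ (index-correct x , index-correct y))
          (f-adj (index x) (index y))
      }
      where
      image? : ∀ v → Dec (∃[ i ] f i ≡ v)
      image? v = search (λ i → f i ≟ v)
      S : Vertex G → Bool
      S v = ⌊ image? v ⌋
      index : Vertex (induced G S) → Vertex H
      index (v , t) = proj₁ (toWitness {a? = image? v} t)
      index-correct : ∀ x → f (index x) ≡ proj₁ x
      index-correct (v , t) = proj₂ (toWitness {a? = image? v} t)
      vertexAt : Vertex H → Vertex (induced G S)
      vertexAt i = f i , fromWitness {a? = image? (f i)} (i , refl)

    -- Both adjacency relations are symmetric and irreflexive, so one order of each pair suffices.
    ascending⇒⇔ : {_<_ : Rel (Vertex H) 0ℓ} → Trichotomous _≡_ _<_ → {f : Vertex H → Vertex G} →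
      (∀ {i j} → i < j → Adj (f i) (f j) ⇔ Graph.Adj H i j) →
      ∀ i j → Adj (f i) (f j) ⇔ Graph.Adj H i j
    ascending⇒⇔ compare h i j with compare i j
    ... | tri< i<j _ _ = h i<j
    ... | tri≈ _ refl _ = mk⇔ (⊥-elim ∘ irrefl) (⊥-elim ∘ Graph.irrefl H)
    ... | tri> _ _ j<i = mk⇔ (Graph.sym H ∘ to ∘ Adj-sym) (Adj-sym ∘ from ∘ Graph.sym H)
      where open Equivalence (h j<i)

    -- In a graph without twins a vertex is determined by its neighbours.
    twinless⇒Embeds : Twinless H → (f : Vertex H → Vertex G) →
      (∀ i j → Adj (f i) (f j) ⇔ Graph.Adj H i j) → Embeds H
    twinless⇒Embeds twinless f f-adj = f , inj , f-adj
      where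
      transfer : ∀ {i j} → f i ≡ f j → ∀ k → Graph.Adj H i k → Graph.Adj H j k
      transfer {i} {j} eq k e = Equivalence.to (f-adj j k)
        (subst (λ v → Adj v (f k)) eq (Equivalence.from (f-adj i k) e))
      inj : Injective _≡_ _≡_ f
      inj {i} {j} eq = twinless i j (transfer eq) (transfer (sym eq))

  -- Decides reduces on each pair, so that the table lists the edges and non-edges
  -- (0,1), (0,2), …, (1,2), … of the pattern in lexicographic order.
  table⇒induced : ∀ {n es} {_ : True (twinless? n es)} (xs : Vec (Vertex G) n) →
    All (λ (i , j) → Decides (Graph.adj? (fromEdges n es) i j)
                             (Adj (Vec.lookup xs i) (Vec.lookup xs j)))
      (ascendingPairs n) →
    ∃[ S ] (induced G S ≅ fromEdges n es)
  table⇒induced {n} {es} {tw} xs table = Embeds⇒induced Fin.any?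
    (twinless⇒Embeds {fromEdges n es} (toWitness tw) (Vec.lookup xs)
      (ascending⇒⇔ {fromEdges n es} Fin.<-cmp λ {i} {j} i<j →
      Decides⇒⇔ (Graph.adj? (fromEdges n es) i j) (All.lookup table
        (∈-filter⁺ (λ (i , j) → i Fin.<? j)
          (∈-cartesianProduct⁺ (∈-allFin i) (∈-allFin j)) i<j))))

  -- Extracting induced paths from trails.

  -- Constraining the last vertex (by L) apart from the others (by N) lets the same
  -- lemmas treat paths to a fixed end and paths stopped at the first neighbour of
  -- some vertex.
  data Trail (N L : Pred (Vertex G) 0ℓ) : ℕ → Vertex G → Set where
    [_] : ∀ {s} → L s → Trail N L 0 s
    cons : ∀ {n s c} → N s → Adj s c → Trail N L n c → Trail N L (suc n) s

  -- An induced path with first vertex `s` and remaining vertices `qs`. The `All` clause rules out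
  -- repetitions as well as chords.
  data Chordless (N L : Pred (Vertex G) 0ℓ) : Vertex G → List (Vertex G) → Set where
    [_] : ∀ {s} → L s → Chordless N L s []
    cons : ∀ {s c qs} → N s → Adj s c → All (λ z → ¬ (s ≡ z ⊎ Adj s z)) qs →
      Chordless N L c qs → Chordless N L s (c ∷ qs)

  module _ {N L : Pred (Vertex G) 0ℓ} where

    -- The new vertex is attached at the last vertex of the path that it equals or is adjacent to,
    -- so nothing beyond can form a chord.
    extend : ∀ {s c qs} → N s → Chordless N L c qs → Any (λ z → s ≡ z ⊎ Adj s z) (c ∷ qs) →
      ∃[ qs′ ] (Chordless N L s qs′ × List.length qs′ ≤ suc (List.length qs))
    extend {s} Ns Q near with Q
    extend {s} Ns Q (here (inj₁ refl)) | [ l ] = [] , Q , z≤n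
    extend {s} Ns Q (here (inj₂ e)) | [ l ] = _ , cons Ns e [] Q , ℕ.≤-refl
    extend {s} {qs = qs} Ns Q near | cons _ _ _ Q′ with any? (λ z → (s ≟ z) ⊎-dec adj? s z) qs
    ... | yes near′ = let qs′ , P , le = extend Ns Q′ near′ in qs′ , P , ℕ.m≤n⇒m≤1+n le
    extend Ns Q (here (inj₁ refl)) | cons _ _ _ Q′ | no _ = _ , Q , ℕ.n≤1+n _
    extend Ns Q (here (inj₂ e)) | cons _ _ _ Q′ | no far = _ , cons Ns e (¬Any⇒All¬ _ far) Q , ℕ.≤-refl
    extend Ns Q (there near) | cons _ _ _ Q′ | no far = contradiction near far

    reduce : ∀ {n s} → Trail N L n s →
      ∃[ qs ] (Chordless N L s qs × List.length qs ≤ n)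
    reduce [ l ] = [] , [ l ] , z≤n
    reduce (cons Ns e t) with reduce t
    ... | qs , Q , le with extend Ns Q (here (inj₂ e))
    ... | qs′ , Q′ , le′ = qs′ , Q′ , ℕ.≤-trans le′ (s≤s le)

    chordless-step : ∀ {s qs} → Chordless N L s qs → ∀ {i j} → toℕ j ≡ suc (toℕ i) →
      Adj (lookup (s ∷ qs) i) (lookup (s ∷ qs) j)
    chordless-step [ _ ] {j = zero} ()
    chordless-step (cons _ e _ _) {zero} {suc zero} _ = e
    chordless-step (cons _ _ _ Q) {suc i} {suc j} eq = chordless-step Q (ℕ.suc-injective eq)

    chordless-last : ∀ {s qs} → Chordless N L s qs → L (lookup (s ∷ qs) (fromℕ (List.length qs)))
    chordless-last [ l ] = l
    chordless-last (cons _ _ _ Q) = chordless-last Q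

    chordless-nonlast : ∀ {s qs} → Chordless N L s qs → ∀ i → toℕ i < List.length qs →
      N (lookup (s ∷ qs) i)
    chordless-nonlast (cons Ns _ _ _) zero _ = Ns
    chordless-nonlast (cons _ _ _ Q) (suc i) (s≤s lt) = chordless-nonlast Q i lt

    chordless-≢ : ∀ {s qs} → Chordless N L s qs → ∀ {i j} → i Fin.< j →
      lookup (s ∷ qs) i ≢ lookup (s ∷ qs) j
    chordless-≢ [ _ ] {zero} {zero} ()
    chordless-≢ (cons _ e _ _) {zero} {suc zero} _ = Adj⇒≢ e
    chordless-≢ (cons _ _ far _) {zero} {suc (suc j)} _ = All.lookup far (∈-lookup j) ∘ inj₁
    chordless-≢ (cons _ _ _ Q) {suc i} {suc j} (s≤s lt) = chordless-≢ Q lt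

    chordless-adj : ∀ {s qs} → Chordless N L s qs → ∀ {i j} → i Fin.< j →
      Adj (lookup (s ∷ qs) i) (lookup (s ∷ qs) j) → toℕ j ≡ suc (toℕ i)
    chordless-adj [ _ ] {zero} {zero} ()
    chordless-adj (cons _ e _ _) {zero} {suc zero} _ _ = refl
    chordless-adj (cons _ _ far _) {zero} {suc (suc j)} _ a =
      contradiction (inj₂ a) (All.lookup far (∈-lookup j))
    chordless-adj (cons _ _ _ Q) {suc i} {suc j} (s≤s lt) a = cong suc (chordless-adj Q lt a)

    chordless-injective : ∀ {s qs} → Chordless N L s qs → Injective _≡_ _≡_ (lookup (s ∷ qs))
    chordless-injective Q {i} {j} eq with Fin.<-cmp i j
    ... | tri< i<j _ _ = contradiction eq (chordless-≢ Q i<j)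
    ... | tri≈ _ i≡j _ = i≡j
    ... | tri> _ _ j<i = contradiction (sym eq) (chordless-≢ Q j<i)

    -- Closing an induced path to a cycle by an apex.

    module _ {s qs y} (Q : Chordless N L s qs) (y~s : Adj y s)
      (y~L : ∀ {z} → L z → Adj y z) (y≁N : ∀ {z} → N z → z ≢ s → ¬ Adj y z) where

      private
        n : ℕ
        n = suc (suc (List.length qs))

        -- The apex takes position 0 and shifts the path by one, so the wrap-around edge of the
        -- cycle joins the apex to the last vertex of the path.
        around : Fin n → Vertex G
        around zero = y
        around (suc i) = lookup (s ∷ qs) i

      apex-adj : ∀ j → Adj y (lookup (s ∷ qs) j) → toℕ j ≡ 0 ⊎ toℕ j ≡ List.length qs
      apex-adj zero _ = inj₁ refl
      apex-adj j@(suc _) a with ℕ.m≤n⇒m<n∨m≡n (s≤s⁻¹ (Fin.toℕ<n j))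
      ... | inj₁ lt = contradiction a
        (y≁N (chordless-nonlast Q j lt) (≢-sym (chordless-≢ Q {zero} {j} (s≤s z≤n))))
      ... | inj₂ eq = inj₂ eq

      around-adj : ∀ {i j} → i Fin.< j → Adj (around i) (around j) ⇔ Graph.Adj (cycle n) i j
      around-adj {zero} {suc j} _ = mk⇔ to from
        where
        to : Adj y (lookup (s ∷ qs) j) → Graph.Adj (cycle n) zero (suc j)
        to a with apex-adj j a
        ... | inj₁ eq = (λ ()) , inj₁ (inj₁ (cong suc eq))
        ... | inj₂ eq = (λ ()) , inj₂ (inj₂ (cong (λ m → suc (suc m)) eq , refl))
        from : Graph.Adj (cycle n) zero (suc j) → Adj y (lookup (s ∷ qs) j)
        from (_ , inj₁ (inj₁ eq)) with Fin.toℕ-injective {j = zero} (ℕ.suc-injective eq)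
        ... | refl = y~s
        from (_ , inj₂ (inj₂ (eq , _)))
          with Fin.toℕ-injective {i = j} {j = fromℕ (List.length qs)}
                 (trans (ℕ.suc-injective (ℕ.suc-injective eq)) (sym (Fin.toℕ-fromℕ _)))
        ... | refl = y~L (chordless-last Q)
      around-adj {suc i} {suc j} (s≤s i<j) = mk⇔ to from
        where
        to : Adj (lookup (s ∷ qs) i) (lookup (s ∷ qs) j) → Graph.Adj (cycle n) (suc i) (suc j)
        to a = (λ eq → ℕ.<-irrefl (cong toℕ (Fin.suc-injective eq)) i<j) ,
          inj₁ (inj₁ (cong suc (chordless-adj Q i<j a)))
        from : Graph.Adj (cycle n) (suc i) (suc j) → Adj (lookup (s ∷ qs) i) (lookup (s ∷ qs) j)
        from (_ , inj₁ (inj₁ eq)) = chordless-step Q (ℕ.suc-injective eq)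
        from (_ , inj₂ (inj₁ eq)) = contradiction (s≤s⁻¹ (ℕ.≤-reflexive (sym eq))) (ℕ.<-asym i<j)

      apex⇒cycle : (∀ {z} → N z → y ≢ z) → ∃[ S ] (induced G S ≅ cycle n)
      apex⇒cycle y≢N = Embeds⇒induced {cycle n} Fin.any?
        (around , injective , ascending⇒⇔ {cycle n} Fin.<-cmp around-adj)
        where
        y≢ : ∀ j → y ≢ lookup (s ∷ qs) j
        y≢ j with ℕ.m≤n⇒m<n∨m≡n (s≤s⁻¹ (Fin.toℕ<n j))
        ... | inj₁ lt = y≢N (chordless-nonlast Q j lt)
        ... | inj₂ eq with Fin.toℕ-injective {i = j} (trans eq (sym (Fin.toℕ-fromℕ _)))
        ... | refl = Adj⇒≢ (y~L (chordless-last Q))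
        injective : Injective _≡_ _≡_ around
        injective {zero} {zero} _ = refl
        injective {zero} {suc j} eq = contradiction eq (y≢ j)
        injective {suc i} {zero} eq = contradiction (sym eq) (y≢ i)
        injective {suc i} {suc j} eq = cong suc (chordless-injective Q eq)

  -- Induced paths with at most two edges: an apex closes them to at most a 4-cycle, which is not a
  -- hole.
  data Short (N L : Pred (Vertex G) 0ℓ) (s : Vertex G) : Set where
    at     : L s → Short N L s
    edge   : ∀ {t} → L t → Adj s t → Short N L s
    cherry : ∀ {z t} → N z → L t → Adj s z → Adj z t → s ≢ t → ¬ Adj s t → Short N L s

  -- An induced path of length at least three extracted from the trail would be
  -- closed by y to a hole.
  short : Free Hole-D-X₅-F G → ∀ {N L n s y} → Trail N L n s → Adj y s →
    (∀ {z} → L z → Adj y z) → (∀ {z} → N z → z ≢ s → ¬ Adj y z) → (∀ {z} → N z → y ≢ z) →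
    Short N L s
  short free trail y~s y~L y≁N y≢N with reduce trail
  ... | _ , [ l ] , _ = at l
  ... | _ , cons _ e _ [ l ] , _ = edge l e
  ... | _ , cons _ e (far ∷ []) (cons Nz e′ _ [ l ]) , _ =
    cherry Nz l e e′ (far ∘ inj₁) (far ∘ inj₂)
  ... | _ , Q@(cons _ _ _ (cons _ _ _ (cons _ _ _ _))) , _ =
    let S , iso = apex⇒cycle Q y~s y~L y≁N y≢N
    in ⊥-elim (free (is-hole _ (s≤s (s≤s (s≤s (s≤s (s≤s z≤n)))))) S iso)

  -- Stopping at the first vertex in `T` makes `∁ T` available before it. With `T` the neighbours of
  -- an apex, this is the non-adjacency that `short` asks of `N`.
  truncate : ∀ {R T n s} → Unary.Decidable T → Trail R (R ∩ T) n s →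
    ∃[ m ] Trail (R ∩ ∁ T) (R ∩ T) m s
  truncate T? [ l ] = _ , [ l ]
  truncate {s = s} T? (cons r e t) with T? s
  ... | yes Ts = _ , [ r , Ts ]
  ... | no ¬Ts = _ , cons (r , ¬Ts) e (proj₂ (truncate T? t))

  -- Trails along sequences; induced and shortest paths as sequences.

  module _ {N L : Pred (Vertex G) 0ℓ} (f : ℕ → Vertex G) where

    ascend-+ : ∀ m i {k} → (∀ j → i ≤ j → j < m + i → N (f j) × Adj (f j) (f (suc j))) →
      Trail N L k (f (m + i)) → Trail N L (m + k) (f i)
    ascend-+ zero i h t = t
    ascend-+ (suc m) i {k} h t = let Ni , e = h i ℕ.≤-refl (s≤s (ℕ.m≤n+m i m)) in
      cons Ni e (ascend-+ m (suc i)
        (λ j i<j j< → h j (ℕ.<⇒≤ i<j) (subst (j <_) (ℕ.+-suc m i) j<))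
        (subst (λ l → Trail N L k (f l)) (sym (ℕ.+-suc m i)) t))

    descend-+ : ∀ m i {k} → (∀ j → i ≤ j → j < m + i → N (f (suc j)) × Adj (f j) (f (suc j))) →
      Trail N L k (f i) → Trail N L (m + k) (f (m + i))
    descend-+ zero i h t = t
    descend-+ (suc m) i h t = let Nm , e = h (m + i) (ℕ.m≤n+m i m) ℕ.≤-refl in
      cons Nm (Adj-sym e) (descend-+ m i (λ j i≤j j< → h j i≤j (ℕ.m≤n⇒m≤1+n j<)) t)

    ascend : ∀ {i n k} → i ≤ n → (∀ j → i ≤ j → j < n → N (f j) × Adj (f j) (f (suc j))) →
      Trail N L k (f n) → Trail N L (n ∸ i + k) (f i)
    ascend {i} {n} {k} i≤n h t = ascend-+ (n ∸ i) i
      (λ j i≤j j< → h j i≤j (subst (j <_) (ℕ.m∸n+n≡m i≤n) j<))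
      (subst (λ l → Trail N L k (f l)) (sym (ℕ.m∸n+n≡m i≤n)) t)

    descend : ∀ {i n k} → i ≤ n → (∀ j → i ≤ j → j < n → N (f (suc j)) × Adj (f j) (f (suc j))) →
      Trail N L k (f i) → Trail N L (n ∸ i + k) (f n)
    descend {i} {n} {k} i≤n h t = subst (λ l → Trail N L (n ∸ i + k) (f l)) (ℕ.m∸n+n≡m i≤n)
      (descend-+ (n ∸ i) i (λ j i≤j j< → h j i≤j (subst (j <_) (ℕ.m∸n+n≡m i≤n) j<)) t)

  record InducedSequence (n : ℕ) (w : ℕ → Vertex G) : Set where
    field
      step  : ∀ {j} → j < n → Adj (w j) (w (suc j))
      chord : ∀ {i j} → i ≤ n → j ≤ n → Adj (w i) (w j) → j ≡ suc i ⊎ i ≡ suc j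

  -- Minimality is kept as the absence of shortcuts: neither one edge nor two edges through an
  -- arbitrary `z` can bridge a longer stretch of `p`.
  record Geodesic (d : ℕ) (p : ℕ → Vertex G) : Set where
    field
      step  : ∀ {j} → j < d → Adj (p j) (p (suc j))
      near₁ : ∀ {i j} → i ≤ d → j ≤ d → Adj (p i) (p j) → j ≤ suc i
      near₂ : ∀ {i j z} → i ≤ d → j ≤ d → Adj (p i) z → Adj z (p j) → j ≤ suc (suc i)

  -- An undominated vertex with at least two vertices after it on the shortest path.

  module Undominated (free : Free Hole-D-X₅-F G) {n d w p}
    (W : InducedSequence n w) (P : Geodesic d p) (start : w 0 ≡ p 0) (end : w n ≡ p d)
    (k : ℕ) (k+3≤d : suc (suc (suc k)) ≤ d)
    (x≁w : ∀ {j} → 0 < j → j < n → ¬ Adj (p (suc k)) (w j))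
    (x≢w : ∀ {j} → 0 < j → j < n → p (suc k) ≢ w j) where

    open Geodesic P
    module W = InducedSequence W

    private
      a x b c : Vertex G
      a = p k
      x = p (suc k)
      b = p (suc (suc k))
      c = p (suc (suc (suc k)))

      k+2≤d : suc (suc k) ≤ d
      k+2≤d = ℕ.<⇒≤ k+3≤d
      k+1≤d : suc k ≤ d
      k+1≤d = ℕ.<⇒≤ k+2≤d
      k≤d : k ≤ d
      k≤d = ℕ.<⇒≤ k+1≤d

      a~x : Adj a x
      a~x = step k+1≤d
      x~b : Adj x b
      x~b = step k+2≤d
      b~c : Adj b c
      b~c = step k+3≤d
      a≁b : ¬ Adj a b
      a≁b e = ℕ.<-irrefl refl (near₁ k≤d k+2≤d e)

    OffX OnP : Pred (Vertex G) 0ℓ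
    OffX z = x ≢ z × ¬ Adj x z
    OnP z = ∃[ j ] (j ≤ d × z ≡ p j)

    -- The vertices allowed on a trail from `a` to `b` with apex `x`: only the start `a` may be
    -- adjacent to `x`. The bound `lo` forces common neighbours found on `w` to lie beyond a given
    -- position.
    Between Avoiding : ℕ → Pred (Vertex G) 0ℓ
    Between lo z = ∃[ j ] (lo < j × j < n × z ≡ w j)
    Avoiding lo z = z ≡ a ⊎ (OffX z × (OnP z ⊎ Between lo z))

    -- If `x` were `p j`, its edge to `b` would become a shortcut from `p j` to `b`.
    p-before : ∀ {j} → j < k → OffX (p j)
    p-before {j} j<k =
      (λ x≡ → ℕ.<⇒≱ j<k (ℕ.<⇒≤ (s≤s⁻¹ (near₁ j≤d k+2≤d (subst (λ v → Adj v b) x≡ x~b))))) ,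
      (λ e → ℕ.<⇒≱ j<k (s≤s⁻¹ (near₁ j≤d k+1≤d (Adj-sym e))))
      where
      j≤d : j ≤ d
      j≤d = ℕ.≤-trans (ℕ.<⇒≤ j<k) k≤d

    p-after : ∀ {j} → suc (suc k) < j → j ≤ d → OffX (p j)
    p-after lt j≤d =
      (λ x≡ → ℕ.<⇒≱ lt (ℕ.m≤n⇒m≤1+n (near₁ k≤d j≤d (subst (Adj a) x≡ a~x)))) ,
      (λ e → ℕ.<⇒≱ lt (near₁ k+1≤d j≤d e))

    w-off : ∀ {j} → 0 < j → j < n → OffX (w j)
    w-off 0<j j<n = x≢w 0<j j<n , x≁w 0<j j<n

    -- Up along `w` from `i` to the shared end, then down along `p` to `l`. Where the segment of `p`
    -- is nonempty, the shared end is covered by the condition on `p`.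
    alongWP : ∀ {N L m} i l → i ≤ n → l ≤ d →
      (∀ j → i ≤ j → j < n → N (w j)) → (∀ j → l < j → j ≤ d → N (p j)) →
      Trail N L m (p l) → ∃[ m′ ] Trail N L m′ (w i)
    alongWP {N} {L} {m} i l i≤n l≤d Nw Np t = _ ,
      ascend w i≤n (λ j i≤j j<n → Nw j i≤j j<n , W.step j<n)
        (subst (Trail N L (d ∸ l + m)) (sym end)
          (descend p l≤d (λ j l≤j j<d → Np (suc j) (s≤s l≤j) j<d , step j<d) t))

    -- Since `x` closes no hole, `a` and `b` have a common neighbour among the allowed vertices. On
    -- `p` it could only be `x`, so it lies on `w`.
    common : ∀ {lo m} → Trail (Avoiding lo) (_≡ b) m a →
      ∃[ j ] (lo < j × j < n × Adj a (w j) × Adj (w j) b)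
    common trail with short free {y = x} trail (Adj-sym a~x)
      (λ { refl → x~b })
      (λ { (inj₁ z≡a) z≢a → contradiction z≡a z≢a ; (inj₂ ((_ , x≁z) , _)) _ → x≁z })
      (λ { (inj₁ refl) → ≢-sym (Adj⇒≢ a~x) ; (inj₂ ((x≢z , _) , _)) → x≢z })
    -- If `a` were `b`, the edge from `b` to `c` would join positions `k` and `k+3`.
    ... | at a≡b = contradiction
                     (near₁ k≤d k+3≤d (subst (λ v → Adj v c) (sym a≡b) b~c))
                     (ℕ.<⇒≱ (ℕ.m≤n⇒m≤1+n ℕ.≤-refl))
    ... | edge refl a~b = contradiction a~b a≁b
    ... | cherry (inj₁ refl) _ a~a _ _ _ = contradiction a~a irrefl
    ... | cherry (inj₂ (_ , inj₂ (j , lo<j , j<n , refl))) refl a~w w~b _ _ =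
      j , lo<j , j<n , a~w , w~b
    ... | cherry (inj₂ ((x≢z , _) , inj₁ (j , j≤d , refl))) refl a~z z~b _ _ =
      -- The two edges pin `j` to `k+1` from both sides, which makes `z` equal to `x`.
      contradiction (cong p (ℕ.≤-antisym (s≤s⁻¹ (near₁ j≤d k+2≤d z~b)) (near₁ k≤d j≤d a~z))) x≢z

    avoiding-w : ∀ {lo j} → lo < j → j < n → Avoiding lo (w j)
    avoiding-w lo<j j<n = inj₂ (w-off (ℕ.≤-<-trans z≤n lo<j) j<n , inj₂ (_ , lo<j , j<n , refl))

    avoiding-after : ∀ {lo} j → suc (suc k) < j → j ≤ d → Avoiding lo (p j)
    avoiding-after j lt j≤d = inj₂ (p-after lt j≤d , inj₁ (j , j≤d , refl))

    common₀ : ∃[ j ] (0 < j × j < n × Adj a (w j) × Adj (w j) b)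
    -- The trail goes back along `p` from `a` to the start, along all of `w`, and back along `p`
    -- from the end to `b`.
    common₀ = common (descend p z≤n
      (λ j _ j<k → before (suc j) j<k , step (ℕ.≤-trans j<k k≤d)) (proj₂ rest))
      where
      before : ∀ j → j ≤ k → Avoiding 0 (p j)
      before j j≤k with ℕ.m≤n⇒m<n∨m≡n j≤k
      ... | inj₁ j<k = inj₂ (p-before j<k , inj₁ (j , ℕ.≤-trans j≤k k≤d , refl))
      ... | inj₂ refl = inj₁ refl
      rest : ∃[ m ] Trail (Avoiding 0) (_≡ b) m (p 0)
      rest = subst (λ v → ∃[ m ] Trail (Avoiding 0) (_≡ b) m v) start
        (alongWP 0 (suc (suc k)) z≤n k+2≤d
          (λ { zero _ _ → subst (Avoiding 0) (sym start) (before 0 z≤n)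
             ; (suc j) _ j<n → avoiding-w (s≤s z≤n) j<n })
          avoiding-after [ refl ])

    -- Beyond the last common neighbour of `a` and `b` on `w`.

    module LastCommon (i : ℕ) (0<i : 0 < i) (i<n : i < n) (a~y : Adj a (w i)) (y~b : Adj (w i) b)
      (a≁w : ∀ {j} → i < j → j < n → ¬ Adj a (w j)) where

      private
        y s : Vertex G
        y = w i
        s = w (suc i)

      R : Pred (Vertex G) 0ℓ
      R z = Between i z ⊎ ∃[ j ] (suc (suc k) < j × j ≤ d × z ≡ p j)

      R-p : ∀ j → suc (suc k) < j → j ≤ d → R (p j)
      R-p j lt j≤d = inj₂ (j , lt , j≤d , refl)

      R-w : ∀ j → i < j → j ≤ n → R (w j)
      R-w j i<j j≤n with ℕ.m≤n⇒m<n∨m≡n j≤n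
      ... | inj₁ j<n = inj₁ (j , i<j , j<n , refl)
      -- The end of `w` is counted as a vertex of `p`; it comes after `b` because `k+3 ≤ d`.
      ... | inj₂ refl = inj₂ (d , k+3≤d , ℕ.≤-refl , end)

      R⇒off : ∀ {z} → R z → OffX z
      R⇒off (inj₁ (j , i<j , j<n , refl)) = w-off (ℕ.<-trans 0<i i<j) j<n
      R⇒off (inj₂ (j , lt , j≤d , refl)) = p-after lt j≤d

      R⇒a≁ : ∀ {z} → R z → ¬ Adj a z
      R⇒a≁ (inj₁ (j , i<j , j<n , refl)) = a≁w i<j j<n
      R⇒a≁ (inj₂ (j , lt , j≤d , refl)) e = ℕ.<⇒≱ lt (ℕ.m≤n⇒m≤1+n (near₁ k≤d j≤d e))

      -- On `w` a neighbour of `y` beyond it must be `s`, as `w` is induced. On `p` it would give a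
      -- two-edge shortcut from `a` past `b`.
      R⇒y≁ : ∀ {z} → R z → z ≢ s → ¬ Adj y z
      R⇒y≁ (inj₁ (j , i<j , j<n , refl)) z≢s y~z with W.chord (ℕ.<⇒≤ i<n) (ℕ.<⇒≤ j<n) y~z
      ... | inj₁ refl = z≢s refl
      ... | inj₂ refl = ℕ.<⇒≱ i<j (ℕ.n≤1+n j)
      R⇒y≁ (inj₂ (j , lt , j≤d , refl)) _ y~z = ℕ.<⇒≱ lt (near₂ k≤d j≤d a~y y~z)

      R⇒y≢ : ∀ {z} → R z → y ≢ z
      R⇒y≢ r refl = R⇒a≁ r a~y

      R⇒b≢ : ∀ {z} → R z → b ≢ z
      R⇒b≢ r refl = proj₂ (R⇒off r) x~b

      y~s : Adj y s
      y~s = W.step i<n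

      s∈R : R s
      s∈R = R-w (suc i) ℕ.≤-refl i<n

      c∈R : R c
      c∈R = R-p _ ℕ.≤-refl k+3≤d

      x≁y : ¬ Adj x y
      x≁y = x≁w 0<i i<n

      trail-s-c : ∀ {L m} → Trail R L m c → ∃[ m′ ] Trail R L m′ s
      trail-s-c = alongWP (suc i) (suc (suc (suc k))) i<n k+3≤d
        (λ j i<j j<n → R-w j i<j (ℕ.<⇒≤ j<n))
        (λ j lt → R-p j (ℕ.<⇒≤ lt))

      -- The squares `a x b y` and `y b z s` share the edge `y b`.
      domino-⊥ : ∀ {z} → R z → Adj s z → Adj z b → ¬ Adj s b → ⊥
      domino-⊥ {z} r s~z z~b s≁b = free is-domino (proj₁ found) (proj₂ found)
        where
        found : ∃[ S ] (induced G S ≅ domino)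
        found = table⇒induced (x ∷ b ∷ z ∷ s ∷ y ∷ a ∷ [])
          ( x~b ∷ proj₂ (R⇒off r) ∷ proj₂ (R⇒off s∈R) ∷ x≁y ∷ Adj-sym a~x
          ∷ Adj-sym z~b ∷ s≁b ∘ Adj-sym ∷ Adj-sym y~b ∷ a≁b ∘ Adj-sym
          ∷ Adj-sym s~z ∷ R⇒y≁ r (≢-sym (Adj⇒≢ s~z)) ∘ Adj-sym ∷ R⇒a≁ r ∘ Adj-sym
          ∷ Adj-sym y~s ∷ R⇒a≁ s∈R ∘ Adj-sym
          ∷ Adj-sym a~y ∷ [])

      -- The square `a x b y` and the triangles `y s b` and `s t b`, consecutive ones sharing an
      -- edge at `b`.
      X₅-⊥ : ∀ {t} → R t → Adj s b → Adj s t → Adj b t → ⊥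
      X₅-⊥ {t} r s~b s~t b~t = free is-X₅ (proj₁ found) (proj₂ found)
        where
        found : ∃[ S ] (induced G S ≅ X₅)
        found = table⇒induced (t ∷ s ∷ y ∷ a ∷ x ∷ b ∷ [])
          ( Adj-sym s~t ∷ R⇒y≁ r (≢-sym (Adj⇒≢ s~t)) ∘ Adj-sym ∷ R⇒a≁ r ∘ Adj-sym
            ∷ proj₂ (R⇒off r) ∘ Adj-sym ∷ Adj-sym b~t
          ∷ Adj-sym y~s ∷ R⇒a≁ s∈R ∘ Adj-sym ∷ proj₂ (R⇒off s∈R) ∘ Adj-sym ∷ s~b
          ∷ Adj-sym a~y ∷ x≁y ∘ Adj-sym ∷ y~b
          ∷ a~x ∷ a≁b
          ∷ x~b ∷ [])

      -- The triangle `b s y` with the square `a x b y` on its side `b y` and the square `b t z s`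
      -- on its side `b s`.
      F-⊥ : ∀ {z t} → R z → R t → Adj s b → Adj s z → Adj z t → Adj b t →
        ¬ Adj b z → t ≢ s → ¬ Adj s t → ⊥
      F-⊥ {z} {t} rz rt s~b s~z z~t b~t b≁z t≢s s≁t = free is-F (proj₁ found) (proj₂ found)
        where
        found : ∃[ S ] (induced G S ≅ F)
        found = table⇒induced (a ∷ x ∷ b ∷ t ∷ z ∷ s ∷ y ∷ [])
          ( a~x ∷ a≁b ∷ R⇒a≁ rt ∷ R⇒a≁ rz ∷ R⇒a≁ s∈R ∷ a~y
          ∷ x~b ∷ proj₂ (R⇒off rt) ∷ proj₂ (R⇒off rz) ∷ proj₂ (R⇒off s∈R) ∷ x≁y
          ∷ b~t ∷ b≁z ∷ Adj-sym s~b ∷ Adj-sym y~b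
          ∷ Adj-sym z~t ∷ s≁t ∘ Adj-sym ∷ R⇒y≁ rt t≢s ∘ Adj-sym
          ∷ Adj-sym s~z ∷ R⇒y≁ rz (≢-sym (Adj⇒≢ s~z)) ∘ Adj-sym
          ∷ Adj-sym y~s ∷ [])

      triangle-⊥ : Adj s b → ⊥
      triangle-⊥ s~b with short free {y = b}
        -- The trail is cut at the first neighbour of `b` other than `s`; one exists, since `c` is
        -- such a neighbour.
        (proj₂ (truncate (λ z → adj? b z ×-dec ¬? (z ≟ s))
          (proj₂ (trail-s-c [ c∈R , b~c , c≢s ]))))
        (Adj-sym s~b)
        (proj₁ ∘ proj₂)
        (λ (_ , ¬t) z≢s b~z → ¬t (b~z , z≢s))
        (R⇒b≢ ∘ proj₁)
        where
        c≢s : c ≢ s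
        -- Otherwise `a`, `y`, `c` would bridge three steps of `p` with two edges.
        c≢s c≡s = ℕ.<-irrefl refl (near₂ k≤d k+3≤d a~y (subst (Adj y) (sym c≡s) y~s))
      ... | at (_ , _ , s≢s) = s≢s refl
      ... | edge (r , b~t , _) s~t = X₅-⊥ r s~b s~t b~t
      ... | cherry (rz , ¬t) (rt , b~t , t≢s) s~z z~t _ s≁t =
        F-⊥ rz rt s~b s~z z~t b~t (λ b~z → ¬t (b~z , ≢-sym (Adj⇒≢ s~z))) t≢s s≁t

      last-common-⊥ : ⊥
      last-common-⊥ with short free {L = _≡ b} {y = y}
        (proj₂ (trail-s-c (cons c∈R (Adj-sym b~c) [ refl {x = b} ])))
        y~s (λ { refl → y~b }) R⇒y≁ R⇒y≢
      ... | at s≡b = R⇒b≢ s∈R (sym s≡b)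
      ... | edge refl s~b = triangle-⊥ s~b
      ... | cherry r refl s~z z~b _ s≁b = domino-⊥ r s~z z~b s≁b

    -- Induction on a bound `m` for the distance from `i` to `n`: a neighbour of `a` beyond `i`
    -- starts a trail that yields a common neighbour beyond `i`.
    common-⊥ : ∀ m i → n ≤ m + i → 0 < i → i < n → Adj a (w i) → Adj (w i) b → ⊥
    common-⊥ zero i n≤i _ i<n _ _ = ℕ.<⇒≱ i<n n≤i
    common-⊥ (suc m) i n≤ 0<i i<n a~y y~b
      with ℕ.anyUpTo? (λ j → (i ℕ.<? j) ×-dec adj? a (w j)) n
    ... | no none = LastCommon.last-common-⊥ i 0<i i<n a~y y~b
      (λ i<j j<n a~w → none (_ , j<n , i<j , a~w))
    ... | yes (l , l<n , i<l , a~w) =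
      let j , i<j , j<n , a~j , j~b = common (cons (inj₁ refl) a~w
            (proj₂ (alongWP l (suc (suc k)) (ℕ.<⇒≤ l<n) k+2≤d
              (λ j l≤j j<n → avoiding-w (ℕ.<-≤-trans i<l l≤j) j<n)
              avoiding-after [ refl ])))
      in common-⊥ m j
           (ℕ.≤-trans n≤ (ℕ.≤-trans (ℕ.≤-reflexive (sym (ℕ.+-suc m i))) (ℕ.+-monoʳ-≤ m i<j)))
           (ℕ.<-trans 0<i i<j) j<n a~j j~b

    undominated-⊥ : ⊥
    undominated-⊥ = let i , 0<i , i<n , a~y , y~b = common₀ in
      common-⊥ n i (ℕ.m≤m+n n i) 0<i i<n a~y y~b

  -- Positions on a path, and reversal.

  clamp : ∀ n → ℕ → Fin (suc n)
  clamp zero _ = zero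
  clamp (suc n) zero = zero
  clamp (suc n) (suc j) = suc (clamp n j)

  toℕ-clamp : ∀ {n j} → j ≤ n → toℕ (clamp n j) ≡ j
  toℕ-clamp {zero} z≤n = refl
  toℕ-clamp {suc n} z≤n = refl
  toℕ-clamp (s≤s j≤n) = cong suc (toℕ-clamp j≤n)

  clamp-≡ : ∀ {n j} {i : Fin (suc n)} → j ≤ n → toℕ i ≡ j → clamp n j ≡ i
  clamp-≡ j≤n eq = Fin.toℕ-injective (trans (toℕ-clamp j≤n) (sym eq))

  -- The sum is the length of a route following `p` to position `i`, taking `c` edges to position
  -- `j`, and following `p` to its end.
  gap : ∀ i {j d} c → j ≤ d → d ≤ i + (c + (d ∸ j)) → j ≤ c + i
  gap i {j} {d} c j≤d le = ℕ.+-cancelʳ-≤ (d ∸ j) j (c + i) (begin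
    j + (d ∸ j)       ≡⟨ ℕ.m+[n∸m]≡n j≤d ⟩
    d                 ≤⟨ le ⟩
    i + (c + (d ∸ j)) ≡⟨ ℕ.+-assoc i c (d ∸ j) ⟨
    i + c + (d ∸ j)   ≡⟨ cong (_+ (d ∸ j)) (ℕ.+-comm i c) ⟩
    c + i + (d ∸ j)   ∎)
    where open ℕ.≤-Reasoning

  reverse-induced : ∀ {n w} → InducedSequence n w → InducedSequence n (λ j → w (n ∸ j))
  reverse-induced {n} {w} W = record
    { step  = λ {j} j<n → Adj-sym (subst (λ l → Adj (w (n ∸ suc j)) (w l)) (sym (ℕ.+-∸-assoc 1 j<n))
                (step (subst (_≤ n) (ℕ.+-∸-assoc 1 j<n) (ℕ.m∸n≤m n j))))
    ; chord = λ {i} {j} i≤n j≤n e → swap (Sum.map (flipped i≤n) (flipped j≤n)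
                (chord (ℕ.m∸n≤m n i) (ℕ.m∸n≤m n j) e))
    }
    where
    open InducedSequence W
    flipped : ∀ {i j} → i ≤ n → n ∸ j ≡ suc (n ∸ i) → i ≡ suc j
    flipped {i} {j} i≤n eq = ℕ.∸-cancelˡ-≡ i≤n j<n
      (ℕ.suc-injective (trans (sym eq) (ℕ.+-∸-assoc 1 j<n)))
      where
      j<n : j < n
      j<n = ℕ.m∸n≢0⇒n<m λ z → contradiction (trans (sym z) eq) λ ()

  reverse-geodesic : ∀ {d p} → Geodesic d p → Geodesic d (λ j → p (d ∸ j))
  reverse-geodesic {d} {p} P = record
    { step  = λ {j} j<d → Adj-sym (subst (λ l → Adj (p (d ∸ suc j)) (p l)) (sym (ℕ.+-∸-assoc 1 j<d))
                (step (subst (_≤ d) (ℕ.+-∸-assoc 1 j<d) (ℕ.m∸n≤m d j))))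
    ; near₁ = λ {i} {j} _ j≤d e →
        reversed 1 j≤d (near₁ (ℕ.m∸n≤m d j) (ℕ.m∸n≤m d i) (Adj-sym e))
    ; near₂ = λ {i} {j} _ j≤d e e′ →
        reversed 2 j≤d (near₂ (ℕ.m∸n≤m d j) (ℕ.m∸n≤m d i) (Adj-sym e′) (Adj-sym e))
    }
    where
    open Geodesic P
    reversed : ∀ {i j} c → j ≤ d → d ∸ i ≤ c + (d ∸ j) → j ≤ c + i
    reversed {i} c j≤d le = gap i c j≤d (ℕ.≤-trans (ℕ.m≤n+m∸n d i) (ℕ.+-monoʳ-≤ i le))

  -- Combining the cases for the undominated vertex.

  distance-2-⊥ : Free Hole-D-X₅-F G → ∀ {n w x} → InducedSequence n w → 3 ≤ n →
    Adj x (w 0) → Adj x (w n) →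
    (∀ {j} → 0 < j → j < n → ¬ Adj x (w j)) → (∀ {j} → 0 < j → j < n → x ≢ w j) → ⊥
  distance-2-⊥ free {n@(suc (suc (suc _)))} {w} {x} W (s≤s (s≤s (s≤s _))) x~start x~end x≁w x≢w
    with short free {N = λ z → ∃[ j ] (j < n × z ≡ w j)} {L = _≡ w n}
      (ascend w z≤n (λ j _ j<n → (j , j<n , refl) , InducedSequence.step W j<n) [ refl ])
      x~start (λ { refl → x~end })
      (λ { (zero , _ , refl) z≢s → contradiction refl z≢s
         ; (suc j , j<n , refl) _ → x≁w (s≤s z≤n) j<n })
      (λ { (zero , _ , refl) → Adj⇒≢ x~start
         ; (suc j , j<n , refl) → x≢w (s≤s z≤n) j<n })
  -- If the ends of `w` coincided, `w n` would be adjacent to `w 1`, forcing `n` to be 2.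
  ... | at s≡t with chord {n} {1} ℕ.≤-refl (s≤s z≤n) (subst (λ v → Adj v (w 1)) s≡t (step (s≤s z≤n)))
    where open InducedSequence W
  ...   | inj₁ ()
  ...   | inj₂ ()
  distance-2-⊥ free W _ _ _ _ _ | edge refl e with InducedSequence.chord W z≤n ℕ.≤-refl e
  ...   | inj₁ ()
  ...   | inj₂ ()
  distance-2-⊥ free W _ _ _ _ _ | cherry (j , j<n , refl) refl e e′ _ _
    with InducedSequence.chord W z≤n (ℕ.<⇒≤ j<n) e
       | InducedSequence.chord W (ℕ.<⇒≤ j<n) ℕ.≤-refl e′
  ... | inj₁ refl | inj₁ ()
  ... | inj₁ refl | inj₂ ()

  dominated : Free Hole-D-X₅-F G → ∀ {n d w p} → InducedSequence n w → 3 ≤ n → Geodesic d p →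
    w 0 ≡ p 0 → w n ≡ p d → ∀ k → 0 < k → k < d →
    (∀ {j} → 0 < j → j < n → ¬ Adj (p k) (w j)) → (∀ {j} → 0 < j → j < n → p k ≢ w j) → ⊥
  dominated free {n} W 3≤n P start end (suc k) _ k+2≤d x≁w x≢w with ℕ.m≤n⇒m<n∨m≡n k+2≤d
  ... | inj₁ k+3≤d = Undominated.undominated-⊥ free W P start end k k+3≤d x≁w x≢w
  dominated free {n} {p = p} W 3≤n P start end (suc zero) _ _ x≁w x≢w | inj₂ refl =
    distance-2-⊥ free W 3≤n
      (subst (Adj (p 1)) (sym start) (Adj-sym (step (s≤s z≤n))))
      (subst (Adj (p 1)) (sym end) (step (s≤s (s≤s z≤n))))
      x≁w x≢w
    where open Geodesic P
  dominated free {n} {w = w} {p} W 3≤n P start end (suc (suc k)) _ _ x≁w x≢w | inj₂ refl =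
    -- The last internal vertex of `p` is at position 1 after reversal, hence the index 0 for its
    -- predecessor.
    Undominated.undominated-⊥ free (reverse-induced W) (reverse-geodesic P) end
      (trans (cong w (ℕ.n∸n≡0 n)) (trans start (cong p (sym (ℕ.n∸n≡0 k)))))
      0 (s≤s (s≤s (s≤s z≤n)))
      (λ 0<j j<n → x≁w (ℕ.m<n⇒0<n∸m j<n) (ℕ.∸-monoʳ-< 0<j (ℕ.<⇒≤ j<n)))
      (λ 0<j j<n → x≢w (ℕ.m<n⇒0<n∸m j<n) (ℕ.∸-monoʳ-< 0<j (ℕ.<⇒≤ j<n)))

  -- From walks to sequences.

  module _ {u v : Vertex G} where

    at-position : Walk G u v → ℕ → Vertex G
    at-position W j = vertex W (clamp (length W) j)

    at-start : ∀ W → at-position W 0 ≡ u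
    at-start W = trans (cong (vertex W) (clamp-≡ z≤n refl)) (Walk.start W)

    at-end : ∀ W → at-position W (length W) ≡ v
    at-end W = trans (cong (vertex W) (clamp-≡ ℕ.≤-refl (Fin.toℕ-fromℕ _))) (Walk.end W)

    at-step : ∀ W {j} → j < length W → Adj (at-position W j) (at-position W (suc j))
    at-step W {j} j<n
      rewrite clamp-≡ {i = inject₁ (Fin.fromℕ< j<n)} (ℕ.<⇒≤ j<n)
                (trans (Fin.toℕ-inject₁ _) (Fin.toℕ-fromℕ< j<n))
            | clamp-≡ {i = suc (Fin.fromℕ< j<n)} j<n (cong suc (Fin.toℕ-fromℕ< j<n))
      = Walk.step W (Fin.fromℕ< j<n)

    induced⇒sequence : ∀ W → IsInducedPath {G} W → InducedSequence (length W) (at-position W)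
    induced⇒sequence W (_ , adj) = record
      { step  = at-step W
      ; chord = λ {i} {j} i≤n j≤n e → Sum.map
          (λ eq → trans (sym (toℕ-clamp j≤n)) (trans eq (cong suc (toℕ-clamp i≤n))))
          (λ eq → trans (sym (toℕ-clamp i≤n)) (trans eq (cong suc (toℕ-clamp j≤n))))
          (Equivalence.to (adj _ _) e)
      }

    -- Distance is minimal over paths, so the trail is first reduced to an induced path that is no
    -- longer.
    distance-≤ : ∀ {d m} → IsDistance G u v d → Trail U (_≡ v) m u → d ≤ m
    distance-≤ (_ , minimal) trail with reduce trail
    ... | qs , Q , le = ℕ.≤-trans (minimal path (chordless-injective Q)) le
      where
      path : Walk G u v
      path = record
        { length = List.length qs
        ; vertex = lookup (u ∷ qs)
        ; start  = refl
        ; end    = chordless-last Q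
        ; step   = λ i → chordless-step Q (cong suc (sym (Fin.toℕ-inject₁ i)))
        }

    shortest⇒geodesic : ∀ P → IsDistance G u v (length P) → Geodesic (length P) (at-position P)
    shortest⇒geodesic P dist = record
      { step  = at-step P
      ; near₁ = λ i≤d j≤d e → gap _ 1 j≤d (distance-≤ dist (first i≤d (cons tt e (rest j≤d))))
      ; near₂ = λ i≤d j≤d e e′ →
          gap _ 2 j≤d (distance-≤ dist (first i≤d (cons tt e (cons tt e′ (rest j≤d)))))
      }
      where
      p : ℕ → Vertex G
      p = at-position P
      d : ℕ
      d = length P
      first : ∀ {i m} → i ≤ d → Trail U (_≡ v) m (p i) → Trail U (_≡ v) (i + m) u
      first {i} {m} i≤d t = subst (Trail U (_≡ v) (i + m)) (at-start P)
        (ascend p z≤n (λ j _ j<i → tt , at-step P (ℕ.<-≤-trans j<i i≤d)) t)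
      rest : ∀ {j} → j ≤ d → Trail U (_≡ v) (d ∸ j) (p j)
      rest {j} j≤d = subst (λ m → Trail U (_≡ v) m (p j)) (ℕ.+-identityʳ (d ∸ j))
        (ascend p j≤d (λ i _ i<d → tt , at-step P i<d) [ at-end P ])

    m₃-dominates-SP : Free Hole-D-X₅-F G → ∀ W P → W ∈ m₃ G u v → P ∈ SP G u v →
      Dominates {G} W P
    m₃-dominates-SP free W P (induced , 3≤n) (_ , dist) x (k , 0<k , k<d , refl)
      -- Both ways of being dominated are decided by a search over the positions of `W`, so it
      -- suffices to refute their joint failure.
      with Fin.any? (λ i → (0 ℕ.<? toℕ i) ×-dec (toℕ i ℕ.<? length W) ×-dec adj? x (vertex W i))
         | Fin.any? (λ i → vertex W i ≟ x)
    ... | yes (i , 0<i , i<n , e) | _ = inj₁ (vertex W i , (i , 0<i , i<n , refl) , e)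
    ... | no _ | yes x∈W = inj₂ x∈W
    ... | no none | no x∉W = ⊥-elim (dominated free (induced⇒sequence W induced) 3≤n
      (shortest⇒geodesic P dist)
      (trans (at-start W) (sym (at-start P))) (trans (at-end W) (sym (at-end P)))
      (toℕ k) 0<k k<d
      (λ 0<j j<n e → let eq = sym (toℕ-clamp (ℕ.<⇒≤ j<n)) in
        none (_ , subst (0 <_) eq 0<j , subst (_< length W) eq j<n ,
              subst (λ z → Adj z _) at-k e))
      (λ _ _ eq → x∉W (_ , trans (sym eq) at-k)))
      where
      at-k : at-position P (toℕ k) ≡ vertex P k
      at-k = cong (vertex P) (clamp-≡ (ℕ.<⇒≤ k<d) refl)

theorem7 : (G : Graph) → Finite G → Connected G → Free Hole-D-X₅-F G → G ∈ m₃ / SP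
theorem7 G (_ , vertices) _ free u v _ W P =
  m₃-dominates-SP G (via-injection (↔⇒↣ vertices) Fin._≟_) free W P
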